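{- Let $D$ be a strongly connected digraph of order $n\geq 3$ and let $z_0$ be a vertex of $D$ such that $d(x)+d(y)\geq 2n-1$ for every pair of non-adjacent distinct vertices $x,y\in V(D)\setminus\{z_0\}$. Then $D$ is Hamiltonian or contains a directed cycle of length $n-1$.
   Context: All digraphs are finite, without loops and without multiple arcs (opposite arcs $xy$ and $yx$ may both be present; a pair of opposite arcs forms a cycle of length 2). For a vertex $x$, $d(x)=d^+(x)+d^-(x)$. Two distinct vertices $x,y$ are adjacent if $xy$ or $yx$ is an arc. A digraph is Hamiltonian if it contains a directed cycle through all its vertices; the length of a cycle is its number of vertices. -}

module Defs where

open import Data.Nat using (ℕ; zero; suc; _+_; _∸_; _≤_)
open import Data.Bool using (Bool; true; false; T)
open import Data.Fin using (Fin; zero; suc; toℕ; fromℕ<)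
open import Data.List using (List; []; _∷_; length; filter; tabulate)
open import Data.Product using (Σ; ∃; _×_; _,_)
open import Data.Sum using (_⊎_)
open import Relation.Nullary using (¬_)
open import Relation.Binary.PropositionalEquality using (_≡_; _≢_)
open import Function.Definitions using (Injective)
open import Data.Nat.DivMod using (_%_; m%n<n)
open import Data.Bool.Properties using (T?)

record Digraph (n : ℕ) : Set where
  field
    arc    : Fin n → Fin n → Bool
    noLoop : ∀ x → arc x x ≡ false
open Digraph public

count : ∀ {n} → (Fin n → Bool) → ℕ
count {n} p = length (filter (λ i → T? (p i)) (tabulate {n = n} (λ i → i)))

outdeg indeg deg : ∀ {n} → Digraph n → Fin n → ℕ
outdeg D x = count (λ y → arc D x y)
indeg  D x = count (λ y → arc D y x)
deg    D x = outdeg D x + indeg D x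

Arc : ∀ {n} → Digraph n → Fin n → Fin n → Set
Arc D x y = T (arc D x y)

Adjacent : ∀ {n} → Digraph n → Fin n → Fin n → Set
Adjacent D x y = Arc D x y ⊎ Arc D y x

data Walk {n} (D : Digraph n) : Fin n → Fin n → Set where
  here : ∀ {x} → Walk D x x
  step : ∀ {x y z} → Arc D x y → Walk D y z → Walk D x z

StronglyConnected : ∀ {n} → Digraph n → Set
StronglyConnected D = ∀ x y → Walk D x y

next : ∀ {k} → Fin k → Fin k
next {suc k} i = fromℕ< (m%n<n (suc (toℕ i)) (suc k))

HasCycleOfLength : ∀ {n} → Digraph n → ℕ → Set
HasCycleOfLength {n} D k =
  2 ≤ k × Σ (Fin k → Fin n) (λ c → Injective _≡_ _≡_ c × (∀ i → Arc D (c i) (c (next i))))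

Hamiltonian : ∀ {n} → Digraph n → Set
Hamiltonian {n} D = HasCycleOfLength D n

{-# OPTIONS --safe #-}
module Submission where

-- Take a cycle C leaving out as few vertices other than z₀ as possible, let R be its complement, and suppose that R
-- contains such a vertex.  Among the paths w → … → w′ through R that contain some v ≠ z₀, with w and w′ on C (possibly
-- equal), one takes a path whose gap c on C, the stretch strictly between w and w′, is shortest.  If all vertices of c
-- other than z₀ could be inserted between consecutive vertices of the remaining path from w′ to w, that path and the one
-- through R would close up to a better cycle.  So some u ≠ z₀ of c cannot be inserted, and neither can v; by minimality
-- of the gap v is not adjacent to c, and no path v → x → u or u → x → v runs through R.  Counting arcs gives
-- d(v) + d(u) ≤ 2n − 2.  Only x = z₀ can violate the last claim, in one direction, and then one of the arcs wv and vw′ is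
-- missing, which makes up for it.  If there is no such path at all, then no vertex of R other than z₀ is adjacent to C, and
-- the same count applies to v and any vertex of C.

open import Defs
open import Data.Nat using (ℕ; zero; suc; _+_; _*_; _∸_; _≤_; _<_; z≤n; s≤s)
open import Data.Nat.Properties
open import Data.Nat.ListAction using (sum)
open import Data.Nat.ListAction.Properties using (sum-++; sum-↭)
open import Data.Nat.Solver using (module +-*-Solver)
open import Data.Nat.DivMod using (_%_; m<n⇒m%n≡m; n%n≡0)
open import Data.Bool using (Bool; true; false; T; not)
open import Data.Bool.Properties using (T?)
open import Data.Fin using (Fin; zero; suc; toℕ; fromℕ<)
import Data.Fin.Properties as Fin
open import Data.List using (List; []; _∷_; _++_; [_]; length; map; filter; allFin; lookup)
open import Data.List.Properties using (++-assoc; length-++; length-tabulate; map-++)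
open import Data.List.Membership.Propositional using (_∈_; find; lose)
open import Data.List.Membership.Propositional.Properties
  using (∈-++⁺ˡ; ∈-++⁺ʳ; ∈-++⁻; ∈-∃++; ∈-allFin; ∈-lookup)
import Data.List.Membership.DecPropositional as DecMembership
open import Data.List.Relation.Unary.All as All using ([]; _∷_)
import Data.List.Relation.Unary.All.Properties as All
open import Data.List.Relation.Unary.Any using (here; there; any?)
open import Data.List.Relation.Unary.AllPairs using ([]; _∷_)
open import Data.List.Relation.Unary.Unique.Propositional using (Unique)
open import Data.List.Relation.Unary.Unique.Propositional.Properties using (allFin⁺)
open import Data.List.Relation.Binary.Permutation.Propositional
  using (_↭_; module PermutationReasoning; ↭-refl; ↭-sym; ↭-trans; ↭-prep; ↭-reflexive; ↭⇒↭ₛ)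
open import Data.List.Relation.Binary.Permutation.Propositional.Properties
  using (∈-resp-↭; ↭-length; shift; shifts; ++⁺; ++⁺ˡ; ++⁺ʳ; map⁺; ++-commutativeMonoid)
import Data.List.Relation.Binary.Permutation.Setoid.Properties as PermSetoid
import Algebra.Solver.CommutativeMonoid as CommutativeMonoidSolver
open import Data.Vec as Vec using (Vec; []; _∷_)
import Data.Vec.Properties as Vec
open import Data.Product using (Σ; ∃; ∃-syntax; _×_; _,_; proj₁; proj₂)
open import Data.Sum using (_⊎_; inj₁; inj₂; swap)
open import Data.Empty using (⊥; ⊥-elim)
open import Data.Unit using (tt)
open import Function using (_∘_; case_of_)
open import Function.Definitions using (Injective)
open import Relation.Nullary using (¬_; Dec; does; yes; no)
open import Relation.Nullary.Decidable using (map′; _×-dec_; _⊎-dec_; _→-dec_; ¬?; decidable-stable)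
open import Relation.Binary.Construct.Closure.ReflexiveTransitive using (Star; ε; _◅_; _◅◅_)
open import Relation.Binary.PropositionalEquality
  using (_≡_; _≢_; refl; sym; trans; cong; cong₂; subst; setoid)

-- Lists without repetitions and their complements

module _ {A : Set} where

  Unique-resp-↭ : {xs ys : List A} → xs ↭ ys → Unique xs → Unique ys
  Unique-resp-↭ p = PermSetoid.Unique-resp-↭ (setoid A) (↭⇒↭ₛ p)

  Unique-++⁻ : (xs : List A) {ys : List A} → Unique (xs ++ ys) →
    Unique xs × Unique ys × (∀ {x} → x ∈ xs → x ∈ ys → ⊥)
  Unique-++⁻ [] uys = [] , uys , λ ()
  Unique-++⁻ (x ∷ xs) (x∉ ∷ u) with Unique-++⁻ xs u
  ... | uxs , uys , disj = All.++⁻ˡ xs x∉ ∷ uxs , uys , λ where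
    (here refl) y∈ys → All.lookup (All.++⁻ʳ xs x∉) y∈ys refl
    (there y∈xs) y∈ys → disj y∈xs y∈ys

  -- The entries of `xs` are deleted from `ys` one at a time; as `xs` has no repetitions, deleting
  -- `x` leaves the later ones in place.
  complement : {xs : List A} → Unique xs → (ys : List A) →
    (∀ {x} → x ∈ xs → x ∈ ys) → ∃[ r ] ys ↭ xs ++ r
  complement [] ys _ = ys , ↭-refl
  complement {x ∷ xs} (x∉ ∷ u) ys xs⊆ys with ∈-∃++ (xs⊆ys (here refl))
  ... | as , bs , refl with complement u (as ++ bs) xs⊆as++bs
    where
    xs⊆as++bs : ∀ {y} → y ∈ xs → y ∈ as ++ bs
    xs⊆as++bs y∈xs with ∈-resp-↭ (shift x as bs) (xs⊆ys (there y∈xs))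
    ... | here refl = ⊥-elim (All.lookup x∉ y∈xs refl)
    ... | there y∈ = y∈
  ... | r , as++bs↭ = r , ↭-trans (shift x as bs) (↭-prep x as++bs↭)

-- Counting arcs by sums over lists

bit : Bool → ℕ
bit true  = 1
bit false = 0

bit≤1 : ∀ a → bit a ≤ 1
bit≤1 true  = s≤s z≤n
bit≤1 false = z≤n

bit-¬T : ∀ {a} → ¬ T a → bit a ≡ 0
bit-¬T {true}  ¬a = ⊥-elim (¬a tt)
bit-¬T {false} _  = refl

bit-exclusive : ∀ {a b} → (T a → T b → ⊥) → bit a + bit b ≤ 1
bit-exclusive {true}  {true}  ¬ab = ⊥-elim (¬ab tt tt)
bit-exclusive {true}  {false} _   = s≤s z≤n
bit-exclusive {false} {b}     _   = bit≤1 b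

Σ[_] : {A : Set} → (A → ℕ) → List A → ℕ
Σ[ f ] xs = sum (map f xs)

module _ {A : Set} (f : A → ℕ) where

  Σ-++ : ∀ xs ys → Σ[ f ] (xs ++ ys) ≡ Σ[ f ] xs + Σ[ f ] ys
  Σ-++ xs ys = trans (cong sum (map-++ f xs ys)) (sum-++ (map f xs) (map f ys))

  Σ-↭ : ∀ {xs ys} → xs ↭ ys → Σ[ f ] xs ≡ Σ[ f ] ys
  Σ-↭ p = sum-↭ (map⁺ f p)

Σ-+ : {A : Set} (f g : A → ℕ) (xs : List A) → Σ[ (λ x → f x + g x) ] xs ≡ Σ[ f ] xs + Σ[ g ] xs
Σ-+ f g []       = refl
Σ-+ f g (x ∷ xs) = trans (cong (f x + g x +_) (Σ-+ f g xs)) (+-+-swap (f x) (g x) _ _)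
  where
  open +-*-Solver
  +-+-swap : ∀ a b c d → a + b + (c + d) ≡ a + c + (b + d)
  +-+-swap = solve 4 (λ a b c d → a :+ b :+ (c :+ d) := a :+ c :+ (b :+ d)) refl

count-Σ : ∀ {n} (p : Fin n → Bool) → count p ≡ Σ[ bit ∘ p ] (allFin n)
count-Σ {n} p = go (allFin n)
  where
  go : (xs : List (Fin n)) → length (filter (λ i → T? (p i)) xs) ≡ Σ[ bit ∘ p ] xs
  go [] = refl
  go (x ∷ xs) with p x
  ... | true  = cong suc (go xs)
  ... | false = go xs

Σ≤2* : {A : Set} (f : A → ℕ) (xs : List A) → (∀ {x} → x ∈ xs → f x ≤ 2) → Σ[ f ] xs ≤ 2 * length xs
Σ≤2* f [] _ = z≤n
Σ≤2* f (x ∷ xs) f≤2 = subst (f x + Σ[ f ] xs ≤_) (sym (*-suc 2 (length xs)))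
  (+-mono-≤ (f≤2 (here refl)) (Σ≤2* f xs (f≤2 ∘ there)))

module _ {A : Set} (f : A → ℕ) (z : A) (e : ℕ) where

  -- Without repetitions `z` occurs at most once, so the excess is paid at most once.
  Σ≤2*+excess : (∀ x → Dec (x ≡ z)) → {xs : List A} → Unique xs →
    (∀ {x} → x ∈ xs → x ≢ z → f x ≤ 2) → (z ∈ xs → f z ≤ 2 + e) →
    Σ[ f ] xs ≤ 2 * length xs + e
  Σ≤2*+excess _ [] _ _ = z≤n
  Σ≤2*+excess ≟z {x ∷ xs} (x∉ ∷ u) f≤2 fz≤ with ≟z x
  ... | yes refl = begin
    f x + Σ[ f ] xs             ≤⟨ +-mono-≤ (fz≤ (here refl)) (Σ≤2* f xs λ y∈ → f≤2 (there y∈) (All.lookup x∉ y∈ ∘ sym)) ⟩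
    2 + e + 2 * length xs       ≡⟨ +-assoc 2 e _ ⟩
    2 + (e + 2 * length xs)     ≡⟨ cong (2 +_) (+-comm e _) ⟩
    2 + (2 * length xs + e)     ≡⟨ +-assoc 2 (2 * length xs) e ⟨
    2 + 2 * length xs + e       ≡⟨ cong (_+ e) (*-suc 2 (length xs)) ⟨
    2 * suc (length xs) + e     ∎
    where open ≤-Reasoning
  ... | no x≢z = begin
    f x + Σ[ f ] xs             ≤⟨ +-mono-≤ (f≤2 (here refl) x≢z) (Σ≤2*+excess ≟z u (f≤2 ∘ there) (fz≤ ∘ there)) ⟩
    2 + (2 * length xs + e)     ≡⟨ +-assoc 2 (2 * length xs) e ⟨
    2 + 2 * length xs + e       ≡⟨ cong (_+ e) (*-suc 2 (length xs)) ⟨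
    2 * suc (length xs) + e     ∎
    where open ≤-Reasoning

  -- The entry `v` uses nothing of its allowance of 2, which is the 2 gained on the left.
  Σ+2≤2*+excess : (∀ x → Dec (x ≡ z)) → {xs : List A} → Unique xs →
    (∀ {x} → x ∈ xs → x ≢ z → f x ≤ 2) → (z ∈ xs → f z ≤ 2 + e) →
    {v : A} → v ∈ xs → f v ≡ 0 →
    2 + Σ[ f ] xs ≤ 2 * length xs + e
  Σ+2≤2*+excess ≟z {xs} u f≤2 fz≤ {v} v∈xs fv≡0 with ∈-∃++ v∈xs
  ... | as , bs , refl = begin
    2 + Σ[ f ] (as ++ v ∷ bs)             ≡⟨ cong (2 +_) (Σ-↭ f perm) ⟩
    2 + (f v + Σ[ f ] (as ++ bs))         ≡⟨ cong (λ k → 2 + (k + Σ[ f ] (as ++ bs))) fv≡0 ⟩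
    2 + Σ[ f ] (as ++ bs)                 ≤⟨ +-monoʳ-≤ 2 (Σ≤2*+excess ≟z u′ (f≤2 ∘ rest⊆) (fz≤ ∘ rest⊆)) ⟩
    2 + (2 * length (as ++ bs) + e)       ≡⟨ +-assoc 2 (2 * length (as ++ bs)) e ⟨
    2 + 2 * length (as ++ bs) + e         ≡⟨ cong (_+ e) (*-suc 2 (length (as ++ bs))) ⟨
    2 * suc (length (as ++ bs)) + e       ≡⟨ cong (λ k → 2 * k + e) (↭-length perm) ⟨
    2 * length (as ++ v ∷ bs) + e         ∎
    where
    open ≤-Reasoning
    perm = shift v as bs
    rest⊆ : ∀ {x} → x ∈ as ++ bs → x ∈ as ++ v ∷ bs
    rest⊆ = ∈-resp-↭ (↭-sym perm) ∘ there
    u′ : Unique (as ++ bs)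
    u′ with Unique-resp-↭ perm u
    ... | _ ∷ u″ = u″

-- Walks and insertion into a path

module _ {n} (D : Digraph n) where

  private
    infix 4 _⟶_
    _⟶_ : Fin n → Fin n → Set
    _⟶_ = Arc D

  arcsBetween : Fin n → Fin n → ℕ
  arcsBetween v x = bit (arc D v x) + bit (arc D x v)

  -- The list holds the vertices visited after the start, so a closed walk lists each visit once and walks concatenate
  -- by _++_.
  data Seg (a : Fin n) : List (Fin n) → Fin n → Set where
    []  : Seg a [] a
    _∷_ : ∀ {b c xs} → a ⟶ b → Seg b xs c → Seg a (b ∷ xs) c

  Seg-++⁺ : ∀ {a b c xs ys} → Seg a xs b → Seg b ys c → Seg a (xs ++ ys) c
  Seg-++⁺ []      t = t
  Seg-++⁺ (e ∷ s) t = e ∷ Seg-++⁺ s t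

  Seg-++⁻ : ∀ {a c} xs {ys} → Seg a (xs ++ ys) c → ∃[ b ] Seg a xs b × Seg b ys c
  Seg-++⁻ []       s = _ , [] , s
  Seg-++⁻ (x ∷ xs) (e ∷ s) with Seg-++⁻ xs s
  ... | b , s₁ , s₂ = b , e ∷ s₁ , s₂

  end∈ : ∀ {a b xs} → Seg a xs b → b ∈ a ∷ xs
  end∈ []      = here refl
  end∈ (_ ∷ s) = there (end∈ s)

  Insertable : Fin n → Fin n → List (Fin n) → Set
  Insertable u a []       = ⊥
  Insertable u a (z ∷ q) = (a ⟶ u × u ⟶ z) ⊎ Insertable u z q

  insertable? : ∀ u a q → Dec (Insertable u a q)
  insertable? u a []      = no λ ()
  insertable? u a (z ∷ q) = (T? _ ×-dec T? _) ⊎-dec insertable? u z q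

  Insertable-++ : ∀ {y z q} a l → Insertable y z q → Insertable y a (l ++ z ∷ q)
  Insertable-++ a []      i = inj₂ i
  Insertable-++ a (x ∷ l) i = inj₂ (Insertable-++ x l i)

  -- A vertex is chosen only if no later one has an arc to `z`; `u` itself ensures that the search
  -- succeeds.
  lastArcTo : ∀ z {u x c} → u ⟶ z → Seg u c x →
    ∃[ s ] ∃[ t ] ∃[ y ] c ≡ s ++ t × Seg u s y × y ⟶ z × Seg y t x × (∀ {v} → v ∈ t → ¬ v ⟶ z)
  lastArcTo z u⟶z w with go w
    where
    go : ∀ {a c x} → Seg a c x →
      (∃[ s ] ∃[ t ] ∃[ y ] c ≡ s ++ t × Seg a s y × y ⟶ z × Seg y t x × (∀ {v} → v ∈ t → ¬ v ⟶ z))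
      ⊎ (∀ {v} → v ∈ a ∷ c → ¬ v ⟶ z)
    go {a} w with T? (arc D a z)
    go {a} [] | yes a⟶z = inj₁ ([] , [] , a , refl , [] , a⟶z , [] , λ ())
    go {a} [] | no ¬a⟶z = inj₂ λ where (here refl) → ¬a⟶z
    go {a} (e ∷ w) | a? with go w
    ... | inj₁ (s , t , y , refl , w₁ , y⟶z , w₂ , none) = inj₁ (_ , t , y , refl , e ∷ w₁ , y⟶z , w₂ , none)
    ... | inj₂ none with a?
    ...   | yes a⟶z = inj₁ ([] , _ , a , refl , [] , a⟶z , e ∷ w , none)
    ...   | no ¬a⟶z = inj₂ λ where
      (here refl) → ¬a⟶z
      (there v∈)  → none v∈
  ... | inj₁ r    = r
  ... | inj₂ none = ⊥-elim (none (here refl) u⟶z)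

  -- The segment inserted together with u is the longest one that fits between the same two vertices of the path;
  -- the arc of the path that is lost is then of no use to the remaining vertices t.
  insertSegment : ∀ {a q b u c x} → Seg a q b → Insertable u a q → Seg u c x →
    ∃[ s ] ∃[ t ] ∃[ y ] ∃[ q′ ] c ≡ s ++ t × Seg y t x × Seg a q′ b × q′ ↭ (u ∷ s) ++ q ×
      (∀ {v} → v ∈ t → Insertable v a q → Insertable v a q′)
  insertSegment {q = z ∷ q} {u = u} (e ∷ p) (inj₁ (a⟶u , u⟶z)) w with lastArcTo z u⟶z w
  ... | s , t , y , c≡ , w₁ , y⟶z , w₂ , none =
    s , t , y , u ∷ s ++ z ∷ q , c≡ , w₂ , a⟶u ∷ Seg-++⁺ w₁ (y⟶z ∷ p) , ↭-refl , λ where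
      v∈t (inj₁ (_ , v⟶z)) → ⊥-elim (none v∈t v⟶z)
      v∈t (inj₂ i)         → inj₂ (Insertable-++ u s i)
  insertSegment {q = z ∷ q} {u = u} (e ∷ p) (inj₂ i) w with insertSegment p i w
  ... | s , t , y , q′ , c≡ , w₂ , p′ , q′↭ , keep =
    s , t , y , z ∷ q′ , c≡ , w₂ , e ∷ p′ ,
    ↭-trans (↭-prep z q′↭) (↭-sym (shift z (u ∷ s) q)) , λ where
      v∈t (inj₁ j) → inj₁ j
      v∈t (inj₂ j) → inj₂ (keep v∈t j)

  insertVertex : ∀ {a q b u} → Seg a q b → Insertable u a q → ∃[ q′ ] Seg a q′ b × q′ ↭ u ∷ q
  insertVertex p ins with insertSegment p ins []
  ... | []    , _ , _ , q′ , refl , _ , p′ , q′↭ , _ = q′ , p′ , q′↭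
  ... | _ ∷ _ , _ , _ , _  , ()   , _

  -- A vertex v contributes at most one of a ⟶ v and v ⟶ z for every arc az of a path it cannot be inserted into.
  degreeIntoPath : ∀ {v a q b} → Seg a q b → ¬ Insertable v a q →
    Σ[ arcsBetween v ] (a ∷ q) ≤ length q + (bit (arc D v a) + bit (arc D b v))
  degreeIntoPath {v} {a} [] _ = ≤-reflexive (+-identityʳ _)
  degreeIntoPath {v} {a} {z ∷ q} {b} (_ ∷ p) ¬ins = begin
    va + av + Σq                            ≤⟨ +-monoʳ-≤ (va + av) (degreeIntoPath p (¬ins ∘ inj₂)) ⟩
    va + av + (length q + (vz + bv))        ≡⟨ rearrange va av (length q) vz bv ⟩
    (av + vz) + (length q + (va + bv))      ≤⟨ +-monoˡ-≤ _ (bit-exclusive λ a⟶v v⟶z → ¬ins (inj₁ (a⟶v , v⟶z))) ⟩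
    suc (length q + (va + bv))              ∎
    where
    open ≤-Reasoning
    va = bit (arc D v a)
    av = bit (arc D a v)
    vz = bit (arc D v z)
    bv = bit (arc D b v)
    Σq = Σ[ arcsBetween v ] (z ∷ q)
    rearrange : ∀ a b l c d → a + b + (l + (c + d)) ≡ (b + c) + (l + (a + d))
    rearrange = solve 5 (λ a b l c d → a :+ b :+ (l :+ (c :+ d)) := (b :+ c) :+ (l :+ (a :+ d))) refl
      where open +-*-Solver

  -- Degrees as sums over vertices

  deg-Σ : ∀ v → deg D v ≡ Σ[ arcsBetween v ] (allFin n)
  deg-Σ v = trans (cong₂ _+_ (count-Σ (arc D v)) (count-Σ (λ x → arc D x v))) (sym (Σ-+ _ _ (allFin n)))

  arcsBetween-self : ∀ v → arcsBetween v v ≡ 0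
  arcsBetween-self v = cong (λ b → bit b + bit b) (noLoop D v)

  arcsBetween-nonAdjacent : ∀ {v x} → ¬ Adjacent D v x → arcsBetween v x ≡ 0
  arcsBetween-nonAdjacent ¬vx = cong₂ _+_ (bit-¬T (¬vx ∘ inj₁)) (bit-¬T (¬vx ∘ inj₂))

  arcsBetween≤2 : ∀ v x → arcsBetween v x ≤ 2
  arcsBetween≤2 v x = +-mono-≤ (bit≤1 (arc D v x)) (bit≤1 (arc D x v))

  module _ {v u x : Fin n} where

    private
      -- The four arcs are paired into the two possible paths of length 2 through `x`, from `v` to
      -- `u` and from `u` to `v`.
      regroup : arcsBetween v x + arcsBetween u x ≡ (bit (arc D v x) + bit (arc D x u)) + (bit (arc D u x) + bit (arc D x v))
      regroup = solve 4 (λ a b c d → (a :+ b) :+ (c :+ d) := (a :+ d) :+ (c :+ b)) refl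
        (bit (arc D v x)) (bit (arc D x v)) (bit (arc D u x)) (bit (arc D x u))
        where open +-*-Solver

    no2Paths⇒≤2 : (v ⟶ x → x ⟶ u → ⊥) → (u ⟶ x → x ⟶ v → ⊥) → arcsBetween v x + arcsBetween u x ≤ 2
    no2Paths⇒≤2 ¬vxu ¬uxv = ≤-trans (≤-reflexive regroup) (+-mono-≤ (bit-exclusive ¬vxu) (bit-exclusive ¬uxv))

    no2Path⇒≤3 : (v ⟶ x → x ⟶ u → ⊥) ⊎ (u ⟶ x → x ⟶ v → ⊥) → arcsBetween v x + arcsBetween u x ≤ 3
    no2Path⇒≤3 (inj₁ ¬vxu) = ≤-trans (≤-reflexive regroup)
      (+-mono-≤ (bit-exclusive ¬vxu) (+-mono-≤ (bit≤1 (arc D u x)) (bit≤1 (arc D x v))))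
    no2Path⇒≤3 (inj₂ ¬uxv) = ≤-trans (≤-reflexive regroup)
      (+-mono-≤ (+-mono-≤ (bit≤1 (arc D v x)) (bit≤1 (arc D x u))) (bit-exclusive ¬uxv))

  -- Walks through the complement of a cycle

  module _ (R : List (Fin n)) where

    RArc : Fin n → Fin n → Set
    RArc x y = x ⟶ y × y ∈ R

    -- If `x` recurs on the rest of the walk, already made simple, the closed detour up to that
    -- visit is dropped.
    simplePath : ∀ {x y} → x ∈ R → Star RArc x y →
      ∃[ p ] Seg x p y × Unique (x ∷ p) × (∀ {z} → z ∈ x ∷ p → z ∈ R)
    simplePath x∈R ε = [] , [] , [] ∷ [] , λ where (here refl) → x∈R
    simplePath {x} {y} x∈R ((_◅_ {j = w}) (x⟶w , w∈R) path) with simplePath w∈R path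
    ... | p , seg , u , p⊆R with DecMembership._∈?_ Fin._≟_ x (w ∷ p)
    ...   | no x∉ = w ∷ p , x⟶w ∷ seg , All.¬Any⇒All¬ _ x∉ ∷ u , λ where
      (here refl) → x∈R
      (there z∈)  → p⊆R z∈
    ...   | yes (here refl) = p , seg , u , p⊆R
    ...   | yes (there x∈p) with ∈-∃++ x∈p
    ...     | as , bs , refl = bs , suffix seg , proj₁ (proj₂ (Unique-++⁻ (w ∷ as) u)) , p⊆R ∘ ∈-++⁺ʳ (w ∷ as)
      where
      suffix : ∀ {a as} → Seg a (as ++ x ∷ bs) y → Seg x bs y
      suffix {as = []}    (_ ∷ s) = s
      suffix {as = _ ∷ _} (_ ∷ s) = suffix s

    -- `RArc` constrains only the head of an arc. So `In` has to ask for `y ∈ R`, while for `Out`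
    -- the membership of `v` is supplied separately.
    In Out : Fin n → Fin n → Set
    In w v = ∃[ y ] w ⟶ y × y ∈ R × Star RArc y v
    Out v w = ∃[ y ] Star RArc v y × y ⟶ w

    module _ {v x} (v⟶x : v ⟶ x) (x∈R : x ∈ R) where

      In-◅◅ : ∀ {w} → In w v → In w x
      In-◅◅ (y , w⟶y , y∈R , path) = y , w⟶y , y∈R , path ◅◅ ((v⟶x , x∈R) ◅ ε)

      ◅-Out : ∀ {w} → Out x w → Out v w
      ◅-Out (y , path , y⟶w) = y , (v⟶x , x∈R) ◅ path , y⟶w

    module _ {xs : List (Fin n)} (split : ∀ x → x ∈ xs ⊎ x ∈ R) (disj : ∀ {x} → x ∈ xs → x ∈ R → ⊥) where

      firstEntry : ∀ {x a} → Walk D x a → x ∈ R → a ∈ xs → ∃[ w ] w ∈ xs × Out x w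
      firstEntry here x∈R a∈xs = ⊥-elim (disj a∈xs x∈R)
      firstEntry (step {y = y} x⟶y walk) x∈R a∈xs with split y
      ... | inj₁ y∈xs = y , y∈xs , _ , ε , x⟶y
      ... | inj₂ y∈R with firstEntry walk y∈R a∈xs
      ...   | w , w∈xs , out = w , w∈xs , ◅-Out x⟶y y∈R out

      lastExit : ∀ {a x} → Walk D a x → a ∈ xs → x ∈ R → ∃[ w ] w ∈ xs × In w x
      lastExit walk a∈xs x∈R with go walk x∈R
        where
        -- The walk is read from its end: the left alternative means that it has stayed in `R` so
        -- far, and the first vertex of `xs` met is the last exit.
        go : ∀ {a x} → Walk D a x → x ∈ R → (a ∈ R × Star RArc a x) ⊎ ∃[ w ] w ∈ xs × In w x
        go here x∈R = inj₁ (x∈R , ε)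
        go {a} (step a⟶y walk) x∈R with go walk x∈R
        ... | inj₂ found = inj₂ found
        ... | inj₁ (y∈R , path) with split a
        ...   | inj₁ a∈xs = inj₂ (a , a∈xs , _ , a⟶y , y∈R , path)
        ...   | inj₂ a∈R  = inj₁ (a∈R , (a⟶y , y∈R) ◅ path)
      ... | inj₁ (a∈R , _) = ⊥-elim (disj a∈xs a∈R)
      ... | inj₂ found     = found

  -- Cycles with their complements

  record Cycle (R : List (Fin n)) : Set where
    constructor cycle
    field
      {base}     : Fin n
      {vertices} : List (Fin n)
      closed     : Seg base vertices base
      -- This excludes the empty closed walk. Distinctness of the vertices is contained in `cover`,
      -- as `allFin n` has no repetitions.
      base∈      : base ∈ vertices
      cover      : allFin n ↭ vertices ++ R

  module _ {R} (xs : List (Fin n)) (cover : allFin n ↭ xs ++ R) where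

    cover-unique : Unique (xs ++ R)
    cover-unique = Unique-resp-↭ cover (allFin⁺ n)

    cover-disjoint : ∀ {x} → x ∈ xs → x ∈ R → ⊥
    cover-disjoint = proj₂ (proj₂ (Unique-++⁻ xs cover-unique))

    cover-split : ∀ x → x ∈ xs ⊎ x ∈ R
    cover-split x = ∈-++⁻ xs (∈-resp-↭ cover (∈-allFin x))

    cover-length : n ≡ length xs + length R
    cover-length = trans (sym (length-tabulate {n = n} (λ i → i))) (trans (↭-length cover) (length-++ xs))

    cover-deg : ∀ v u → deg D v + deg D u ≡
      Σ[ (λ x → arcsBetween v x + arcsBetween u x) ] xs + Σ[ (λ x → arcsBetween v x + arcsBetween u x) ] R
    cover-deg v u = trans (cong₂ _+_ (deg-Σ v) (deg-Σ u))
      (trans (sym (Σ-+ (arcsBetween v) (arcsBetween u) (allFin n))) (trans (Σ-↭ _ cover) (Σ-++ _ xs R)))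

  -- The two end arcs at `u` are bounded by 2, but those at `v` are kept: a missing one later
  -- offsets the excess of `z₀`.
  Σ-degreesIntoPath : ∀ {v u a q b} → Seg a q b → ¬ Insertable v a q → ¬ Insertable u a q →
    Σ[ (λ x → arcsBetween v x + arcsBetween u x) ] (a ∷ q) ≤ length q + (bit (arc D v a) + bit (arc D b v)) + (length q + 2)
  Σ-degreesIntoPath {v} {u} {a} {q} {b} p ¬v ¬u = ≤-trans (≤-reflexive (Σ-+ (arcsBetween v) (arcsBetween u) (a ∷ q)))
    (+-mono-≤ (degreeIntoPath p ¬v)
      (≤-trans (degreeIntoPath p ¬u) (+-monoʳ-≤ (length q) (+-mono-≤ (bit≤1 (arc D u a)) (bit≤1 (arc D b u))))))

  -- Improving a cycle by a path through its complement

  module _ (z₀ : Fin n) where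

    -- The quantity to be minimised over complements: leaving `z₀` off a cycle is free.
    weight : List (Fin n) → ℕ
    weight = Σ[ (λ x → bit (not (does (x Fin.≟ z₀)))) ]

    weight-∷ : ∀ {x} xs → x ≢ z₀ → weight (x ∷ xs) ≡ suc (weight xs)
    weight-∷ {x} xs x≢z₀ with x Fin.≟ z₀
    ... | yes x≡z₀ = ⊥-elim (x≢z₀ x≡z₀)
    ... | no _     = refl

    weight-∷-z₀ : ∀ xs → weight (z₀ ∷ xs) ≡ weight xs
    weight-∷-z₀ xs with z₀ Fin.≟ z₀
    ... | yes _ = refl
    ... | no z₀≢z₀ = ⊥-elim (z₀≢z₀ refl)

    ∈⇒weight>0 : ∀ {x xs} → x ∈ xs → x ≢ z₀ → 0 < weight xs
    ∈⇒weight>0 {xs = x ∷ xs} (here refl) x≢z₀ rewrite weight-∷ xs x≢z₀ = s≤s z≤n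
    ∈⇒weight>0 {xs = y ∷ xs} (there x∈) x≢z₀ = ≤-trans (∈⇒weight>0 x∈ x≢z₀) (m≤n+m (weight xs) _)

    heavyOrZero : ∀ xs → (∃[ v ] v ∈ xs × v ≢ z₀) ⊎ (weight xs ≡ 0)
    heavyOrZero [] = inj₂ refl
    heavyOrZero (x ∷ xs) with x Fin.≟ z₀
    ... | no x≢z₀ = inj₁ (x , here refl , x≢z₀)
    ... | yes refl with heavyOrZero xs
    ...   | inj₁ (v , v∈ , v≢) = inj₁ (v , there v∈ , v≢)
    ...   | inj₂ w≡0 = inj₂ w≡0

    -- Each insertion leaves a suffix of `c` whose vertices remain insertable; `k` bounds its length
    -- for the recursion. If the remaining walk starts with `z₀`, this vertex goes to `r`; elsewhere
    -- it may be carried along in an inserted segment.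
    insertAll : ∀ k {a q b w c x} → length c ≤ k → Seg a q b → Seg w c x →
      (∀ {u} → u ∈ c → u ≢ z₀ → Insertable u a q) →
      ∃[ q′ ] ∃[ c′ ] ∃[ r ] Seg a q′ b × q′ ↭ c′ ++ q × c ↭ c′ ++ r × weight r ≡ 0
    insertAll k {c = []} _ p _ _ = _ , [] , [] , p , ↭-refl , ↭-refl , refl
    insertAll (suc k) {c = u ∷ c} (s≤s c≤k) p (_ ∷ w) ins with u Fin.≟ z₀
    ... | yes refl with insertAll k c≤k p w (ins ∘ there)
    ...   | q′ , c′ , r , p′ , q′↭ , c↭ , r≡0 =
      q′ , c′ , z₀ ∷ r , p′ , q′↭ , ↭-trans (↭-prep z₀ c↭) (↭-sym (shift z₀ c′ r)) , trans (weight-∷-z₀ r) r≡0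
    insertAll (suc k) {q = q} {c = u ∷ c} (s≤s c≤k) p (_ ∷ w) ins | no u≢z₀
      with insertSegment p (ins (here refl) u≢z₀) w
    ... | s , t , y , q₁ , refl , w₂ , p₁ , q₁↭ , keep
      with insertAll k (≤-trans (≤-trans (m≤n+m (length t) (length s)) (≤-reflexive (sym (length-++ s)))) c≤k) p₁ w₂
             (λ v∈t v≢z₀ → keep v∈t (ins (there (∈-++⁺ʳ s v∈t)) v≢z₀))
    ... | q′ , c′ , r , p′ , q′↭ , t↭ , r≡0 = q′ , (u ∷ s) ++ c′ , r , p′ ,
      ↭-trans q′↭ (↭-trans (++⁺ˡ c′ q₁↭) (↭-trans (shifts c′ (u ∷ s)) (↭-sym (++-assoc-↭ (u ∷ s) c′ q)))) ,
      ↭-trans (++⁺ˡ (u ∷ s) t↭) (↭-sym (++-assoc-↭ (u ∷ s) c′ r)) , r≡0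
      where
      ++-assoc-↭ : (xs ys zs : List (Fin n)) → (xs ++ ys) ++ zs ↭ xs ++ (ys ++ zs)
      ++-assoc-↭ xs ys zs = ↭-reflexive (++-assoc xs ys zs)

    -- The new cycle follows `p` and returns along `q` with `c` inserted. Its complement loses at
    -- least `v` and gains only `r`, of weight 0.
    exchange : ∀ {w p y w′ c x q R} → Seg w p y → y ⟶ w′ → Unique p → (∀ {z} → z ∈ p → z ∈ R) →
      (∃[ v ] v ∈ p × v ≢ z₀) →
      Seg w c x → Seg w′ q w → allFin n ↭ (c ++ w′ ∷ q) ++ R →
      (∀ {u} → u ∈ c → u ≢ z₀ → Insertable u w′ q) →
      ∃[ R′ ] weight R′ < weight R × Cycle R′
    exchange {p = p} {w′ = w′} {c = c} {q = q} {R = R} segp y⟶w′ up p⊆R (v , v∈p , v≢z₀) segc segq cover ins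
      with insertAll (length c) ≤-refl segq segc ins | complement up R p⊆R
    ... | q′ , c′ , r , segq′ , q′↭ , c↭ , r≡0 | R₁ , R↭ = r ++ R₁ , lighter , record
      { closed = Seg-++⁺ segp (y⟶w′ ∷ segq′)
      ; base∈  = ∈-++⁺ʳ p (end∈ segq′)
      ; cover  = begin
          allFin n                                    ↭⟨ cover ⟩
          (c ++ w′ ∷ q) ++ R                          ↭⟨ ++⁺ (++⁺ʳ (w′ ∷ q) c↭) R↭ ⟩
          ((c′ ++ r) ++ w′ ∷ q) ++ (p ++ R₁)          ↭⟨ regroup c′ r [ w′ ] q p R₁ ⟩
          (p ++ w′ ∷ (c′ ++ q)) ++ (r ++ R₁)          ↭⟨ ++⁺ʳ (r ++ R₁) (++⁺ˡ p (↭-prep w′ q′↭)) ⟨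
          (p ++ w′ ∷ q′) ++ (r ++ R₁)                 ∎
      }
      where
      open PermutationReasoning
      regroup : ∀ c′ r w′ q p R₁ → ((c′ ++ r) ++ (w′ ++ q)) ++ (p ++ R₁) ↭ (p ++ (w′ ++ (c′ ++ q))) ++ (r ++ R₁)
      regroup = solve 6 (λ c′ r w′ q p R₁ →
        ((c′ ⊕ r) ⊕ (w′ ⊕ q)) ⊕ (p ⊕ R₁) ⊜ (p ⊕ (w′ ⊕ (c′ ⊕ q))) ⊕ (r ⊕ R₁)) ↭-refl
        where open CommutativeMonoidSolver (++-commutativeMonoid {A = Fin n})
      lighter : weight (r ++ R₁) < weight R
      lighter = ≤-trans (≤-reflexive (cong suc (trans (Σ-++ _ r R₁) (cong (_+ weight R₁) r≡0))))
        (≤-trans (+-monoˡ-≤ (weight R₁) (∈⇒weight>0 v∈p v≢z₀))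
          (≤-reflexive (sym (trans (Σ-↭ _ R↭) (Σ-++ _ p R₁)))))

    -- The direct arc ensures that v survives when the walks into and out of v are shortened to a single path: without it
    -- both of them might have to use z₀.
    record Bypass (R : List (Fin n)) (w v w′ : Fin n) : Set where
      constructor bypass
      field
        v∈R    : v ∈ R
        v≢z₀   : v ≢ z₀
        into   : In R w v
        out    : Out R v w′
        direct : w ⟶ v ⊎ v ⟶ w′

    -- Only the walk on the side away from the direct arc is shortened; `v` is an end of it and so
    -- is kept.
    bypassPath : ∀ {R w v w′} → Bypass R w v w′ →
      ∃[ p ] ∃[ y ] Seg w p y × y ⟶ w′ × Unique p × (∀ {z} → z ∈ p → z ∈ R) × v ∈ p
    bypassPath {v = v} (bypass v∈R _ _ (y , path , y⟶w′) (inj₁ w⟶v)) with simplePath _ v∈R path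
    ... | p , seg , u , p⊆R = v ∷ p , y , w⟶v ∷ seg , y⟶w′ , u , p⊆R , here refl
    bypassPath {v = v} (bypass _ _ (y , w⟶y , y∈R , path) _ (inj₂ v⟶w′)) with simplePath _ y∈R path
    ... | p , seg , u , p⊆R = y ∷ p , v , w⟶y ∷ seg , v⟶w′ , u , p⊆R , end∈ seg

    degreesTooSmall : ∀ S → 2 * n ∸ 1 ≤ S → 2 + S ≤ 2 * n → ⊥
    degreesTooSmall S lower upper =
      <-irrefl refl (≤-trans upper (≤-trans (m≤n+m∸n (2 * n) 1) (s≤s lower)))

    -- Excluding bypasses of a best cycle

    module _ (sparse : ∀ x y → x ≢ y → x ≢ z₀ → y ≢ z₀ → ¬ Adjacent D x y → 2 * n ∸ 1 ≤ deg D x + deg D y) where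

      module _ (R : List (Fin n)) (lightest : ∀ {R′} → weight R′ < weight R → Cycle R′ → ⊥) where

        -- The excess 2 ∸ a that z₀ may contribute is paid for by an arc w ⟶ v or v ⟶ w′ that is missing.
        bypassDegrees : ∀ {c w w′ q v u} → Seg w′ q w → allFin n ↭ (c ++ w′ ∷ q) ++ R →
          Bypass R w v w′ → u ∈ c → u ≢ z₀ →
          ¬ Insertable v w′ q → ¬ Insertable u w′ q →
          (∀ {x} → x ∈ c → ¬ Adjacent D v x) →
          (∀ {x} → x ∈ R → v ⟶ x → x ⟶ u → x ≢ z₀ ⊎ w ⟶ v → ⊥) →
          (∀ {x} → x ∈ R → u ⟶ x → x ⟶ v → x ≢ z₀ ⊎ v ⟶ w′ → ⊥) →
          ⊥
        bypassDegrees {c} {w} {w′} {q} {v} {u} segq cover (bypass v∈R v≢z₀ _ _ direct) u∈c u≢z₀ ¬insv ¬insu nonadj vxu uxv =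
          degreesTooSmall _ (sparse v u v≢u v≢z₀ u≢z₀ (nonadj u∈c)) (begin
            2 + (deg D v + deg D u)                       ≡⟨ cong (2 +_) (cover-deg (c ++ w′ ∷ q) cover v u) ⟩
            2 + (Σ[ f ] (c ++ w′ ∷ q) + ΣR)               ≡⟨ cong (λ k → 2 + (k + ΣR)) (Σ-++ f c (w′ ∷ q)) ⟩
            2 + (Σc + Σq + ΣR)                            ≤⟨ +-cancelˡ-≤ 2 _ _ bound ⟩
            2 * (length c + suc (length q) + length R)    ≡⟨ cong (λ k → 2 * (k + length R)) (length-++ c) ⟨
            2 * (length (c ++ w′ ∷ q) + length R)         ≡⟨ cong (2 *_) (cover-length (c ++ w′ ∷ q) cover) ⟨
            2 * n                                         ∎)
          where
          open ≤-Reasoning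
          f : Fin n → ℕ
          f x = arcsBetween v x + arcsBetween u x
          a = bit (arc D v w′) + bit (arc D w v)
          Σc = Σ[ f ] c
          Σq = Σ[ f ] (w′ ∷ q)
          ΣR = Σ[ f ] R
          v≢u : v ≢ u
          v≢u refl = cover-disjoint (c ++ w′ ∷ q) cover (∈-++⁺ˡ u∈c) v∈R
          unique = Unique-++⁻ (c ++ w′ ∷ q) (cover-unique (c ++ w′ ∷ q) cover)
          fu≡0 : f u ≡ 0
          fu≡0 = cong₂ _+_ (arcsBetween-nonAdjacent (nonadj u∈c)) (arcsBetween-self u)
          fv≡0 : f v ≡ 0
          fv≡0 = cong₂ _+_ (arcsBetween-self v) (arcsBetween-nonAdjacent (nonadj u∈c ∘ swap))
          fc≤2 : ∀ {x} → x ∈ c → f x ≤ 2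
          fc≤2 {x} x∈c = subst (λ k → k + arcsBetween u x ≤ 2) (sym (arcsBetween-nonAdjacent (nonadj x∈c)))
            (arcsBetween≤2 u x)
          boundc : 2 + Σc ≤ 2 * length c + 0
          boundc = Σ+2≤2*+excess f z₀ 0 (Fin._≟ z₀) (proj₁ (Unique-++⁻ c (proj₁ unique)))
            (λ x∈c _ → fc≤2 x∈c) fc≤2 u∈c fu≡0
          -- If both arcs are present, both 2-paths through `z₀` are excluded. If one is missing,
          -- then `a ≤ 1`, and the other still excludes one 2-path, leaving at most 3 arcs.
          fz₀≤ : z₀ ∈ R → f z₀ ≤ 2 + (2 ∸ a)
          fz₀≤ z₀∈R with T? (arc D w v) | T? (arc D v w′)
          ... | yes w⟶v | yes v⟶w′ = ≤-trans
            (no2Paths⇒≤2 (λ e e′ → vxu z₀∈R e e′ (inj₂ w⟶v)) (λ e e′ → uxv z₀∈R e e′ (inj₂ v⟶w′)))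
            (m≤m+n 2 (2 ∸ a))
          ... | no ¬w⟶v | _ = ≤-trans
            (no2Path⇒≤3 (inj₂ (λ e e′ → uxv z₀∈R e e′ (inj₂ v⟶w′))))
            (+-monoʳ-≤ 2 (∸-monoʳ-≤ 2 (+-mono-≤ (bit≤1 (arc D v w′)) (≤-reflexive (bit-¬T ¬w⟶v)))))
            where
            v⟶w′ : v ⟶ w′
            v⟶w′ = case direct of λ where
              (inj₁ w⟶v) → ⊥-elim (¬w⟶v w⟶v)
              (inj₂ e)   → e
          ... | yes w⟶v | no ¬v⟶w′ = ≤-trans
            (no2Path⇒≤3 (inj₁ (λ e e′ → vxu z₀∈R e e′ (inj₂ w⟶v))))
            (+-monoʳ-≤ 2 (∸-monoʳ-≤ 2 (+-mono-≤ (≤-reflexive (bit-¬T ¬v⟶w′)) (bit≤1 (arc D w v)))))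
          boundR : 2 + ΣR ≤ 2 * length R + (2 ∸ a)
          boundR = Σ+2≤2*+excess f z₀ (2 ∸ a) (Fin._≟ z₀) (proj₁ (proj₂ unique))
            (λ x∈R x≢z₀ → no2Paths⇒≤2 (λ e e′ → vxu x∈R e e′ (inj₁ x≢z₀)) (λ e e′ → uxv x∈R e e′ (inj₁ x≢z₀)))
            fz₀≤ v∈R fv≡0
          open +-*-Solver
          -- `u` saves 2 on `c` and `v` saves 2 on `R`. The path exceeds `2 * length q` by at most
          -- `a + 2` and `z₀` adds at most `2 ∸ a`, so `a` cancels.
          bound : 2 + (2 + (Σc + Σq + ΣR)) ≤ 2 + 2 * (length c + suc (length q) + length R)
          bound = begin
            2 + (2 + (Σc + Σq + ΣR))
              ≡⟨ solve 3 (λ c q r → con 2 :+ (con 2 :+ (c :+ q :+ r)) := (con 2 :+ c) :+ (q :+ (con 2 :+ r))) refl Σc Σq ΣR ⟩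
            (2 + Σc) + (Σq + (2 + ΣR))
              ≤⟨ +-mono-≤ boundc (+-mono-≤ (Σ-degreesIntoPath segq ¬insv ¬insu) boundR) ⟩
            (2 * length c + 0) + ((length q + a + (length q + 2)) + (2 * length R + (2 ∸ a)))
              ≡⟨ solve 5 (λ c q r a e → (con 2 :* c :+ con 0) :+ ((q :+ a :+ (q :+ con 2)) :+ (con 2 :* r :+ e))
                    := con 2 :* (c :+ q :+ r) :+ con 2 :+ (a :+ e)) refl (length c) (length q) (length R) a (2 ∸ a) ⟩
            2 * (length c + length q + length R) + 2 + (a + (2 ∸ a))
              ≡⟨ cong (2 * (length c + length q + length R) + 2 +_)
                   (m+[n∸m]≡n (+-mono-≤ (bit≤1 (arc D v w′)) (bit≤1 (arc D w v)))) ⟩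
            2 * (length c + length q + length R) + 2 + 2
              ≡⟨ solve 3 (λ c q r → con 2 :* (c :+ q :+ r) :+ con 2 :+ con 2
                    := con 2 :+ con 2 :* (c :+ (con 1 :+ q) :+ r)) refl (length c) (length q) (length R) ⟩
            2 + 2 * (length c + suc (length q) + length R) ∎

        -- Induction on the length of the gap `c` replaces the choice of a bypass with shortest gap.
        noBypass : ∀ k {c w v w′ q} → length c < k → Seg w (c ++ w′ ∷ q) w →
          allFin n ↭ (c ++ w′ ∷ q) ++ R → Bypass R w v w′ → ⊥
        noBypass (suc k) {c} {w} {v} {w′} {q} (s≤s c≤k) closed cover byp with Seg-++⁻ c closed
        ... | _ , segc , (x⟶w′ ∷ segq)
          with any? (λ u → ¬? (u Fin.≟ z₀) ×-dec ¬? (insertable? u w′ q)) c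
        ... | no none with bypassPath byp
        ...   | p , y , segp , y⟶w′ , up , p⊆R , v∈p
          with exchange segp y⟶w′ up p⊆R (v , v∈p , Bypass.v≢z₀ byp) segc segq cover
                 (λ {u} u∈c u≢z₀ → decidable-stable (insertable? u w′ q) (λ ¬ins → none (lose u∈c (u≢z₀ , ¬ins))))
        ...   | R′ , lighter , cyc = lightest lighter cyc
        noBypass (suc k) {c} {w} {v} {w′} {q} (s≤s c≤k) closed cover byp@(bypass v∈R v≢z₀ into out direct)
          | _ , segc , (x⟶w′ ∷ segq) | yes someU with find someU
        ... | u , u∈c , u≢z₀ , ¬insu =
          bypassDegrees segq cover byp u∈c u≢z₀ ¬insv ¬insu
            -- An arc between `v` and a vertex `x` of the gap is the direct arc of a bypass with `x`
            -- as an end, whose gap is shorter.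
            (λ x∈c → λ where
              (inj₁ v⟶x) → cutʳ x∈c (bypass v∈R v≢z₀ into (_ , ε , v⟶x) (inj₂ v⟶x))
              (inj₂ x⟶v) → cutˡ x∈c (bypass v∈R v≢z₀ (_ , x⟶v , v∈R , ε) out (inj₁ x⟶v)))
            -- If `x ≢ z₀`, then `x` takes over the role of `v`, with direct arc `x⟶u`. If `w⟶v` is
            -- present, `v` keeps its role and its direct arc.
            (λ x∈R v⟶x x⟶u → λ where
              (inj₁ x≢z₀) → cutʳ u∈c (bypass x∈R x≢z₀ (In-◅◅ R v⟶x x∈R into) (_ , ε , x⟶u) (inj₂ x⟶u))
              (inj₂ w⟶v)  → cutʳ u∈c (bypass v∈R v≢z₀ into (◅-Out R v⟶x x∈R (_ , ε , x⟶u)) (inj₁ w⟶v)))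
            (λ x∈R u⟶x x⟶v → λ where
              (inj₁ x≢z₀) → cutˡ u∈c (bypass x∈R x≢z₀ (_ , u⟶x , x∈R , ε) (◅-Out R x⟶v v∈R out) (inj₁ u⟶x))
              (inj₂ v⟶w′) → cutˡ u∈c (bypass v∈R v≢z₀ (In-◅◅ R x⟶v v∈R (_ , u⟶x , x∈R , ε)) out (inj₂ v⟶w′)))
          where
          cutʳ : ∀ {v u} → u ∈ c → Bypass R w v u → ⊥
          cutʳ {u = u} u∈c b with ∈-∃++ u∈c
          ... | X , Y , refl = noBypass k
            (≤-trans (≤-trans (m<m+n (length X) (s≤s z≤n)) (≤-reflexive (sym (length-++ X)))) c≤k)
            (subst (λ l → Seg w l w) assoc closed) (subst (λ l → allFin n ↭ l ++ R) assoc cover) b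
            where
            assoc : (X ++ u ∷ Y) ++ w′ ∷ q ≡ X ++ u ∷ (Y ++ w′ ∷ q)
            assoc = ++-assoc X (u ∷ Y) (w′ ∷ q)
          -- The gap now begins after `u`, so the closed walk is rotated to start at `u`.
          cutˡ : ∀ {v u} → u ∈ c → Bypass R u v w′ → ⊥
          cutˡ {u = u} u∈c b with ∈-∃++ u∈c
          ... | X , Y , refl with Seg-++⁻ X (subst (λ l → Seg w l w) (++-assoc X (u ∷ Y) (w′ ∷ q)) closed)
          ...   | _ , segX , (e ∷ segY) = noBypass k
            (≤-trans (≤-trans (m≤n+m (suc (length Y)) (length X)) (≤-reflexive (sym (length-++ X)))) c≤k)
            (subst (λ l → Seg u l u) (++-assoc Y (w′ ∷ q) (X ++ [ u ])) (Seg-++⁺ segY (Seg-++⁺ segX (e ∷ []))))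
            (↭-trans cover (++⁺ʳ R (rotate X [ u ] Y (w′ ∷ q)))) b
            where
            rotate : ∀ X u Y q → (X ++ (u ++ Y)) ++ q ↭ Y ++ (q ++ (X ++ u))
            rotate = solve 4 (λ X u Y q → (X ⊕ (u ⊕ Y)) ⊕ q ⊜ Y ⊕ (q ⊕ (X ⊕ u))) ↭-refl
              where open CommutativeMonoidSolver (++-commutativeMonoid {A = Fin n})
          ¬insv : ¬ Insertable v w′ q
          ¬insv ins with insertVertex segq ins | ∈-∃++ v∈R
          ... | q′ , segq′ , q′↭ | as , bs , refl = lightest lighter record
            { closed = Seg-++⁺ segc (x⟶w′ ∷ segq′)
            ; base∈  = ∈-++⁺ʳ c (end∈ segq′)
            ; cover  = begin
                allFin n                                      ↭⟨ cover ⟩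
                (c ++ w′ ∷ q) ++ (as ++ v ∷ bs)               ↭⟨ regroup c [ w′ ] q as [ v ] bs ⟩
                (c ++ w′ ∷ (v ∷ q)) ++ (as ++ bs)             ↭⟨ ++⁺ʳ (as ++ bs) (++⁺ˡ c (↭-prep w′ q′↭)) ⟨
                (c ++ w′ ∷ q′) ++ (as ++ bs)                  ∎
            }
            where
            open PermutationReasoning
            regroup : ∀ c w q as v bs → (c ++ (w ++ q)) ++ (as ++ (v ++ bs)) ↭ (c ++ (w ++ (v ++ q))) ++ (as ++ bs)
            regroup = solve 6 (λ c w q as v bs →
              (c ⊕ (w ⊕ q)) ⊕ (as ⊕ (v ⊕ bs)) ⊜ (c ⊕ (w ⊕ (v ⊕ q))) ⊕ (as ⊕ bs)) ↭-refl
              where open CommutativeMonoidSolver (++-commutativeMonoid {A = Fin n})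
            lighter : weight (as ++ bs) < weight (as ++ v ∷ bs)
            lighter = ≤-reflexive (sym (trans (Σ-↭ _ (shift v as bs)) (weight-∷ (as ++ bs) v≢z₀)))

        -- A best cycle leaves out at most z₀

        module _ (strong : StronglyConnected D) (C : Cycle R) where

          open Cycle C renaming (vertices to xs; base to a)

          private
            disjoint = cover-disjoint xs cover
            split    = cover-split xs cover

          rotation : (A B C : List (Fin n)) → A ++ (B ++ C) ↭ C ++ (A ++ B)
          rotation = solve 3 (λ A B C → A ⊕ (B ⊕ C) ⊜ C ⊕ (A ⊕ B)) ↭-refl
            where open CommutativeMonoidSolver (++-commutativeMonoid {A = Fin n})

          -- The rotated list ends with `w`, so `w′` is found in it even if it equals `w`; the gap
          -- is then the rest of the cycle.
          rotateTo : ∀ {w w′} → w ∈ xs → w′ ∈ xs →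
            ∃[ c ] ∃[ q ] Seg w (c ++ w′ ∷ q) w × xs ↭ c ++ w′ ∷ q
          rotateTo {w} w∈xs w′∈xs with ∈-∃++ w∈xs
          ... | A , B , xs≡ with Seg-++⁻ A (subst (λ l → Seg a l a) xs≡ closed)
          ...   | _ , segA , (e ∷ segB)
            with ∈-∃++ (∈-resp-↭ (↭-trans (↭-reflexive xs≡) (rotation A [ w ] B)) w′∈xs)
          ...     | c , q , eq = c , q ,
            subst (λ l → Seg w l w) eq (Seg-++⁺ segB (Seg-++⁺ segA (e ∷ []))) ,
            ↭-trans (↭-reflexive xs≡) (↭-trans (rotation A [ w ] B) (↭-reflexive eq))

          noBypassAt : ∀ {w v w′} → w ∈ xs → w′ ∈ xs → Bypass R w v w′ → ⊥
          noBypassAt w∈xs w′∈xs with rotateTo w∈xs w′∈xs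
          ... | c , q , closed′ , xs↭ = noBypass (suc (length c)) ≤-refl closed′ (↭-trans cover (++⁺ʳ R xs↭))

          -- An arc between `x` and the cycle would be the direct arc of a bypass; strong
          -- connectivity supplies the walk on the other side.
          separated : ∀ {c x} → c ∈ xs → x ∈ R → x ≢ z₀ → ¬ Adjacent D x c
          separated c∈xs x∈R x≢z₀ (inj₁ x⟶c) with lastExit R split disjoint (strong _ _) c∈xs x∈R
          ... | w , w∈xs , into = noBypassAt w∈xs c∈xs (bypass x∈R x≢z₀ into (_ , ε , x⟶c) (inj₂ x⟶c))
          separated c∈xs x∈R x≢z₀ (inj₂ c⟶x) with firstEntry R split disjoint (strong _ _) x∈R c∈xs
          ... | w , w∈xs , out = noBypassAt c∈xs w∈xs (bypass x∈R x≢z₀ (_ , c⟶x , x∈R , ε) out (inj₁ c⟶x))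

          nothingOutside : ∀ {v} → v ∈ R → v ≢ z₀ → ⊥
          nothingOutside {v} v∈R v≢z₀ =
            degreesTooSmall _ (sparse v a v≢a v≢z₀ a≢z₀ (separated base∈ v∈R v≢z₀)) (begin
              2 + (deg D v + deg D a)                   ≡⟨ cong (2 +_) (cover-deg xs cover v a) ⟩
              2 + (Σ[ f ] xs + Σ[ f ] R)                ≤⟨ +-cancelˡ-≤ 2 _ _ bound ⟩
              2 * (length xs + length R)                ≡⟨ cong (2 *_) (cover-length xs cover) ⟨
              2 * n                                     ∎)
            where
            open ≤-Reasoning
            f : Fin n → ℕ
            f x = arcsBetween v x + arcsBetween a x
            unique = Unique-++⁻ xs (cover-unique xs cover)
            v≢a : v ≢ a
            v≢a refl = disjoint base∈ v∈R
            a≢z₀ : a ≢ z₀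
            a≢z₀ refl with lastExit R split disjoint (strong a v) base∈ v∈R
            -- If `z₀` were on the cycle, the vertex `y` at which a walk to `v` enters `R` would
            -- differ from `z₀` and be adjacent to the cycle.
            ... | w , w∈xs , y , w⟶y , y∈R , _ =
              separated w∈xs y∈R (λ where refl → disjoint base∈ y∈R) (inj₂ w⟶y)
            fxs≤2 : ∀ {x} → x ∈ xs → f x ≤ 2
            fxs≤2 {x} x∈xs = subst (λ k → k + arcsBetween a x ≤ 2) (sym (arcsBetween-nonAdjacent (separated x∈xs v∈R v≢z₀)))
              (arcsBetween≤2 a x)
            fR≤2 : ∀ {x} → x ∈ R → x ≢ z₀ → f x ≤ 2
            fR≤2 {x} x∈R x≢z₀ = subst (λ k → arcsBetween v x + k ≤ 2)
              (sym (arcsBetween-nonAdjacent (separated base∈ x∈R x≢z₀ ∘ swap)))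
              (subst (_≤ 2) (sym (+-identityʳ _)) (arcsBetween≤2 v x))
            fa≡0 : f a ≡ 0
            fa≡0 = cong₂ _+_ (arcsBetween-nonAdjacent (separated base∈ v∈R v≢z₀)) (arcsBetween-self a)
            fv≡0 : f v ≡ 0
            fv≡0 = cong₂ _+_ (arcsBetween-self v) (arcsBetween-nonAdjacent (separated base∈ v∈R v≢z₀ ∘ swap))
            open +-*-Solver
            -- Here `z₀` may contribute 4. This excess of 2 uses up half of what is saved at `a` and
            -- `v`.
            bound : 2 + (2 + (Σ[ f ] xs + Σ[ f ] R)) ≤ 2 + 2 * (length xs + length R)
            bound = begin
              2 + (2 + (Σ[ f ] xs + Σ[ f ] R))
                ≡⟨ solve 2 (λ x r → con 2 :+ (con 2 :+ (x :+ r)) := (con 2 :+ x) :+ (con 2 :+ r)) refl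
                     (Σ[ f ] xs) (Σ[ f ] R) ⟩
              (2 + Σ[ f ] xs) + (2 + Σ[ f ] R)
                ≤⟨ +-mono-≤
                     (Σ+2≤2*+excess f z₀ 0 (Fin._≟ z₀) (proj₁ unique) (λ x∈xs _ → fxs≤2 x∈xs) fxs≤2 base∈ fa≡0)
                     (Σ+2≤2*+excess f z₀ 2 (Fin._≟ z₀) (proj₁ (proj₂ unique)) fR≤2
                       (λ _ → +-mono-≤ (arcsBetween≤2 v z₀) (arcsBetween≤2 a z₀)) v∈R fv≡0) ⟩
              (2 * length xs + 0) + (2 * length R + 2)
                ≡⟨ solve 2 (λ x r → (con 2 :* x :+ con 0) :+ (con 2 :* r :+ con 2) := con 2 :+ con 2 :* (x :+ r)) refl
                     (length xs) (length R) ⟩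
              2 + 2 * (length xs + length R) ∎

      -- Descent on the weight replaces the choice of a best cycle: the induction hypothesis is the
      -- minimality required by `nothingOutside`.
      noCycle : StronglyConnected D → (∀ R → weight R ≡ 0 → ¬ Cycle R) → ∀ k R → weight R < k → ¬ Cycle R
      noCycle strong noLong (suc k) R (s≤s R≤k) C with heavyOrZero R
      ... | inj₁ (v , v∈R , v≢z₀) =
        nothingOutside R (λ R′<R → noCycle strong noLong k _ (≤-trans R′<R R≤k)) strong C v∈R v≢z₀
      ... | inj₂ R≡0 = noLong R R≡0 C

  -- A first cycle, and cycles as indexed families

  existsCycle : StronglyConnected D → ∀ {a b} → a ≢ b → ∃[ R ] Cycle R
  existsCycle strong {a} {b} a≢b with strong a b
  ... | here = ⊥-elim (a≢b refl)
  -- A simple path from `y` back to `a` closes up with the arc `a⟶y`.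
  ... | step {y = y} a⟶y _ with simplePath (allFin n) (∈-allFin y) (walk (strong y a))
    where
    walk : ∀ {x z} → Walk D x z → Star (RArc (allFin n)) x z
    walk here       = ε
    walk (step e w) = (e , ∈-allFin _) ◅ walk w
  ...   | p , seg , u , _ with complement u (allFin n) (λ _ → ∈-allFin _)
  ...     | R , cover = R , record { closed = a⟶y ∷ seg ; base∈ = end∈ seg ; cover = cover }

  -- The arc `b ⟶ d` stands for the one that wraps around; a free `d` lets the induction pass to the
  -- tail.
  Seg-lookup : ∀ {a x xs b} → Seg a (x ∷ xs) b → ∀ {d} → b ⟶ d → (i : Fin (length (x ∷ xs))) →
    (Σ (suc (toℕ i) < length (x ∷ xs)) λ i< → lookup (x ∷ xs) i ⟶ lookup (x ∷ xs) (fromℕ< i<))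
    ⊎ (suc (toℕ i) ≡ length (x ∷ xs) × lookup (x ∷ xs) i ⟶ d)
  Seg-lookup (_ ∷ [])     b⟶d zero = inj₂ (refl , b⟶d)
  Seg-lookup (_ ∷ e ∷ s) b⟶d zero = inj₁ (s≤s (s≤s z≤n) , e)
  Seg-lookup (_ ∷ e ∷ s) b⟶d (suc i) with Seg-lookup (e ∷ s) b⟶d i
  ... | inj₁ (i< , arc′)  = inj₁ (s≤s i< , arc′)
  ... | inj₂ (i≡ , arc′)  = inj₂ (cong suc i≡ , arc′)

  Seg⇒HasCycle : ∀ {a xs} → Seg a xs a → Unique xs → 2 ≤ length xs → HasCycleOfLength D (length xs)
  Seg⇒HasCycle {a} {x ∷ xs} closed@(a⟶x ∷ _) u 2≤ = 2≤ , lookup (x ∷ xs) , lookup-injective u , arcs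
    where
    lookup-injective : ∀ {ys : List (Fin n)} → Unique ys → Injective _≡_ _≡_ (lookup ys)
    lookup-injective (y∉ ∷ u) {zero}  {zero}  _  = refl
    lookup-injective (y∉ ∷ u) {zero}  {suc j} eq = ⊥-elim (All.lookup y∉ (∈-lookup j) eq)
    lookup-injective (y∉ ∷ u) {suc i} {zero}  eq = ⊥-elim (All.lookup y∉ (∈-lookup i) (sym eq))
    lookup-injective (y∉ ∷ u) {suc i} {suc j} eq = cong suc (lookup-injective u eq)
    arcs : ∀ i → lookup (x ∷ xs) i ⟶ lookup (x ∷ xs) (next i)
    arcs i with Seg-lookup closed a⟶x i
    ... | inj₁ (i< , e) = subst (λ j → lookup (x ∷ xs) i ⟶ lookup (x ∷ xs) j)
      (Fin.toℕ-injective (trans (Fin.toℕ-fromℕ< i<) (sym (trans (Fin.toℕ-fromℕ< _) (m<n⇒m%n≡m i<))))) e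
    ... | inj₂ (i≡ , e) = subst (λ j → lookup (x ∷ xs) i ⟶ lookup (x ∷ xs) j)
      (Fin.toℕ-injective {i = zero} (sym (trans (Fin.toℕ-fromℕ< _)
        (trans (cong (_% suc (length xs)) i≡) (n%n≡0 (suc (length xs))))))) e

  -- Vectors encode the functions `Fin k → Fin n`, so that they can be searched exhaustively.
  hasCycle? : ∀ k → Dec (HasCycleOfLength D k)
  hasCycle? k = (2 ≤? k) ×-dec map′
    (λ (c , inj , arcs) → Vec.lookup c , (λ {i} {j} → inj i j) , arcs)
    (λ (c , inj , arcs) → Vec.tabulate c ,
      (λ i j eq → inj (trans (sym (Vec.lookup∘tabulate c i)) (trans eq (Vec.lookup∘tabulate c j)))) ,
      (λ i → subst T (sym (cong₂ (arc D) (Vec.lookup∘tabulate c i) (Vec.lookup∘tabulate c (next i)))) (arcs i)))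
    (anyVec? λ c →
      Fin.all? (λ i → Fin.all? λ j → (Vec.lookup c i Fin.≟ Vec.lookup c j) →-dec (i Fin.≟ j))
      ×-dec Fin.all? (λ i → T? _))
    where
    anyVec? : ∀ {k} {P : Vec (Fin n) k → Set} → (∀ c → Dec (P c)) → Dec (∃ P)
    anyVec? {zero}  P? = map′ ([] ,_) (λ where ([] , p) → p) (P? [])
    anyVec? {suc k} P? = map′ (λ (x , c , p) → x ∷ c , p) (λ where (x ∷ c , p) → x , c , p)
      (Fin.any? λ x → anyVec? (λ c → P? (x ∷ c)))

theorem4p5 : ∀ (n : ℕ) (D : Digraph n) (z₀ : Fin n) → 3 ≤ n → StronglyConnected D →
    (∀ x y → x ≢ y → x ≢ z₀ → y ≢ z₀ → ¬ Adjacent D x y → 2 * n ∸ 1 ≤ deg D x + deg D y) →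
    Hamiltonian D ⊎ HasCycleOfLength D (n ∸ 1)
theorem4p5 n@(suc (suc _)) D z₀ (s≤s 2≤n-1@(s≤s _)) strong sparse =
  -- The descent only refutes the absence of a long cycle; decidability turns this into existence.
  decidable-stable (hasCycle? D n ⊎-dec hasCycle? D (n ∸ 1)) λ none →
    let R , C = existsCycle D strong {zero} {suc zero} λ ()
    in noCycle D z₀ sparse strong (λ R R≡0 C → none (longCycle R R≡0 C)) (suc (weight D z₀ R)) R ≤-refl C
  where
  longCycle : ∀ R → weight D z₀ R ≡ 0 → Cycle D R → Hamiltonian D ⊎ HasCycleOfLength D (n ∸ 1)
  longCycle R R≡0 (cycle {vertices = xs} closed _ cover) with Unique-++⁻ xs (cover-unique D xs cover)
  ... | uxs , uR , _ = go R uR R≡z₀ (cover-length D xs cover)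
    where
    R≡z₀ : ∀ {x} → x ∈ R → x ≡ z₀
    R≡z₀ {x} x∈R = decidable-stable (x Fin.≟ z₀) λ x≢z₀ → <-irrefl (sym R≡0) (∈⇒weight>0 D z₀ x∈R x≢z₀)
    -- Being free of repetitions and containing only `z₀`, `R` has at most one entry.
    go : ∀ R → Unique R → (∀ {x} → x ∈ R → x ≡ z₀) → n ≡ length xs + length R →
      Hamiltonian D ⊎ HasCycleOfLength D (n ∸ 1)
    go [] _ _ n≡ = inj₁ (subst (HasCycleOfLength D) (sym n≡xs)
      (Seg⇒HasCycle D closed uxs (subst (2 ≤_) n≡xs (≤-trans 2≤n-1 (n≤1+n _)))))
      where
      n≡xs : n ≡ length xs
      n≡xs = trans n≡ (+-identityʳ _)
    go (x ∷ []) _ _ n≡ = inj₂ (subst (HasCycleOfLength D) (sym n-1≡xs)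
      (Seg⇒HasCycle D closed uxs (subst (2 ≤_) n-1≡xs 2≤n-1)))
      where
      n-1≡xs : n ∸ 1 ≡ length xs
      n-1≡xs = trans (cong (_∸ 1) n≡) (m+n∸n≡m (length xs) 1)
    go (x ∷ y ∷ _) ((x≢y ∷ _) ∷ _) R≡z₀ _ = ⊥-elim (x≢y (trans (R≡z₀ (here refl)) (sym (R≡z₀ (there (here refl))))))
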